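{- Let $S$ and $T$ be two distinct ordered rooted binary trees with the same number of leaves. Let $n$ be the number of internal nodes of each of $S$ and $T$, and let $e$ be the number of common edges of $S$ and $T$. Then the rotation distance $d_R(S,T)$ satisfies $$n-e-1 \;\le\; d_R(S,T) \;\le\; 2(n-e-1).$$
   Context: A tree here is an extended binary tree: a finite ordered (plane) rooted binary tree in which every interior (internal) node has exactly two children, a left child and a right child. A tree with $n$ interior nodes has $n+1$ leaves, numbered $1,\dots,n+1$ in left-to-right order. An internal edge is an edge joining two interior nodes, so a tree with $n\ge 1$ interior nodes has $n-1$ internal edges. Common edges: removing an internal edge of a tree disconnects the tree and so separates the leaves into two sets, the set of leaves below the edge (those descending from its lower endpoint) and the remaining set of leaves (on the side containing the root). An internal edge $e_1$ of $S$ and an internal edge $e_2$ of $T$ form a common edge pair if they induce the same partition of $\{1,\dots,n+1\}$ into the "below" set and the "root side" set, i.e. the set of leaves below $e_1$ in $S$ equals the set of leaves below $e_2$ in $T$. The number $e$ of common edges of $S$ and $T$ is the number of common edge pairs; equivalently, the number of internal edges of $S$ whose set of leaves below equals the set of leaves below some internal edge of $T$. Rotations: write $(X,Y)$ for the tree or subtree whose root has left subtree $X$ and right subtree $Y$. A right rotation at a node whose left child is an interior node replaces the subtree $((A,B),C)$ rooted at that node by $(A,(B,C))$, leaving the rest of the tree unchanged; here $A,B,C$ are arbitrary subtrees (possibly single leaves). A left rotation is the inverse operation, replacing $(A,(B,C))$ by $((A,B),C)$. The rotation distance $d_R(S,T)$ between two trees with the same number of leaves is the minimum number of (left or right) rotations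 needed to transform $S$ into $T$. -}

module Defs where

open import Data.Bool.Properties using () renaming (_≟_ to _≟ᵇ_)
open import Data.Fin.Subset using (Subset; ⊤; ⊥)
open import Data.List.Base using (List; []; _∷_; _++_; map; filter; length)
open import Data.List.Relation.Unary.Any using (Any; any?)
open import Data.Nat.Base using (ℕ; zero; suc; _+_; _≤_; z≤n; s≤s)
open import Data.Nat.Properties using (+-suc; suc-injective)
open import Data.Product.Base using (Σ; ∃; ∃-syntax; _×_; _,_; proj₁; proj₂)
open import Data.Sum.Base using (_⊎_; inj₁; inj₂)
import Data.Vec.Base as Vec
open import Data.Vec.Properties using () renaming (≡-dec to Vec-≡-dec)
open import Data.Vec.Relation.Binary.Equality.Cast using (_≈[_]_)
open import Function.Base using (_∘_)
open import Level using (Level)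
open import Relation.Binary.Construct.Closure.Equivalence as EqClosure
  using (EqClosure)
open import Relation.Binary.Construct.Closure.ReflexiveTransitive
  using (ε; _◅_; _◅◅_)
open import Relation.Binary.Construct.Closure.Symmetric
  using (SymClosure; fwd; bwd)
open import Relation.Binary.Definitions using (DecidableEquality)
open import Relation.Binary.PropositionalEquality
  using (_≡_; refl; sym; trans; cong; cong₂; subst)
open import Relation.Nullary.Decidable
  using (Dec; yes; no; map′; _×-dec_; _⊎-dec_)
open import Relation.Nullary.Negation using (¬_; contradiction)
open import Relation.Unary using (Pred; Decidable)

data Tree : Set where
  leaf : Tree
  node : (l r : Tree) → Tree

_≟_ : DecidableEquality Tree
leaf     ≟ leaf       = yes refl
leaf     ≟ node _ _   = no λ ()
node _ _ ≟ leaf       = no λ ()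
node l r ≟ node l′ r′ =
  map′ (λ (p , q) → cong₂ node p q) (λ { refl → refl , refl })
       ((l ≟ l′) ×-dec (r ≟ r′))

interior : Tree → ℕ
interior leaf       = 0
interior (node l r) = suc (interior l + interior r)

leaves : Tree → ℕ
leaves leaf       = 1
leaves (node l r) = leaves l + leaves r

leaves≡suc-interior : ∀ t → leaves t ≡ suc (interior t)
leaves≡suc-interior leaf       = refl
leaves≡suc-interior (node l r) =
  trans (cong₂ _+_ (leaves≡suc-interior l) (leaves≡suc-interior r))
        (cong suc (+-suc (interior l) (interior r)))

------------------------------------------------------------------------
-- Common edges

data InteriorNode : Tree → Set where
  root  : ∀ {l r} → InteriorNode (node l r)
  left  : ∀ {l r} → InteriorNode l → InteriorNode (node l r)
  right : ∀ {l r} → InteriorNode r → InteriorNode (node l r)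

-- An internal edge is represented by its lower endpoint, an interior
-- node other than the root.
data InternalEdge : Tree → Set where
  left  : ∀ {l r} → InteriorNode l → InternalEdge (node l r)
  right : ∀ {l r} → InteriorNode r → InternalEdge (node l r)

interiorNodes : ∀ t → List (InteriorNode t)
interiorNodes leaf       = []
interiorNodes (node l r) =
  root ∷ map left (interiorNodes l) ++ map right (interiorNodes r)

internalEdges : ∀ t → List (InternalEdge t)
internalEdges leaf       = []
internalEdges (node l r) =
  map left (interiorNodes l) ++ map right (interiorNodes r)

-- Leaves are numbered from left to right, starting at 0: the leaves of l
-- come before those of r in node l r.
leavesBelowNode : ∀ {t} → InteriorNode t → Subset (leaves t)
leavesBelowNode root              = ⊤
leavesBelowNode (left  {r = r} v) = leavesBelowNode v Vec.++ ⊥ {leaves r}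
leavesBelowNode (right {l = l} v) = ⊥ {leaves l} Vec.++ leavesBelowNode v

leavesBelow : ∀ {t} → InternalEdge t → Subset (leaves t)
leavesBelow (left  {r = r} v) = leavesBelowNode v Vec.++ ⊥ {leaves r}
leavesBelow (right {l = l} v) = ⊥ {leaves l} Vec.++ leavesBelowNode v

module _ (S T : Tree) (eq : leaves S ≡ leaves T) where

  CommonEdgePair : InternalEdge S → InternalEdge T → Set
  CommonEdgePair e₁ e₂ = leavesBelow e₁ ≈[ eq ] leavesBelow e₂

  IsCommonEdge : InternalEdge S → Set
  IsCommonEdge e₁ = Any (CommonEdgePair e₁) (internalEdges T)

  isCommonEdge? : Decidable IsCommonEdge
  isCommonEdge? e₁ = any? (λ e₂ → Vec-≡-dec _≟ᵇ_ _ _) (internalEdges T)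

  commonEdges : ℕ
  commonEdges = length (filter isCommonEdge? (internalEdges S))

------------------------------------------------------------------------
-- Rotations

data RightRotation : Tree → Tree → Set where
  rotate : ∀ {A B C} →
           RightRotation (node (node A B) C) (node A (node B C))
  left   : ∀ {l l′ r} → RightRotation l l′ →
           RightRotation (node l r) (node l′ r)
  right  : ∀ {l r r′} → RightRotation r r′ →
           RightRotation (node l r) (node l r′)

Rotation : Tree → Tree → Set
Rotation = SymClosure RightRotation

data Rotations : ℕ → Tree → Tree → Set where
  []  : ∀ {S} → Rotations 0 S S
  _∷_ : ∀ {d S S′ T} → Rotation S S′ → Rotations d S′ T →
        Rotations (suc d) S T

------------------------------------------------------------------------
-- Rotation distance

private
  variable
    p : Level

IsLeast : Pred ℕ p → Pred ℕ p
IsLeast P m = P m × (∀ {k} → P k → m ≤ k)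

least : {P : Pred ℕ p} → Decidable P → ∃ P → ∃ (IsLeast P)
least P? (m , pm) = search P? m pm
  where
  search : {P : Pred ℕ p} → Decidable P → ∀ m → P m → ∃ (IsLeast P)
  search P? zero    pm = 0 , pm , λ _ → z≤n
  search {P = P} P? (suc m) pm with P? 0
  ... | yes p0 = 0 , p0 , λ _ → z≤n
  ... | no ¬p0 with search (P? ∘ suc) m pm
  ...   | k , pk , k≤ = suc k , pk , lower ¬p0 k≤
    where
    lower : ∀ {k} → ¬ P 0 → (∀ {j} → P (suc j) → k ≤ j) →
            ∀ {j} → P j → suc k ≤ j
    lower ¬p0 k≤ {zero}  p0 = contradiction p0 ¬p0
    lower ¬p0 k≤ {suc _} pj = s≤s (k≤ pj)

anyRightRotation? : {P : Pred Tree p} → Decidable P →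
                    ∀ S → Dec (∃[ S′ ] RightRotation S S′ × P S′)
anyRightRotation? P? leaf       = no λ ()
anyRightRotation? {P = P} P? (node l r) =
  map′ (λ { (inj₁ (_ , refl , x))      → _ , rotate , x
          ; (inj₂ (inj₁ (_ , ρ , x))) → _ , left ρ , x
          ; (inj₂ (inj₂ (_ , ρ , x))) → _ , right ρ , x })
       (λ { (_ , rotate  , x) → inj₁ (_ , refl , x)
          ; (_ , left ρ  , x) → inj₂ (inj₁ (_ , ρ , x))
          ; (_ , right ρ , x) → inj₂ (inj₂ (_ , ρ , x)) })
       (atRoot l
        ⊎-dec anyRightRotation? (λ l′ → P? (node l′ r)) l
        ⊎-dec anyRightRotation? (λ r′ → P? (node l r′)) r)
  where
  atRoot : ∀ l → Dec (Σ (Tree × Tree) λ (A , B) →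
                      l ≡ node A B × P (node A (node B r)))
  atRoot leaf       = no λ ()
  atRoot (node A B) = map′ (λ x → _ , refl , x) (λ { (_ , refl , x) → x })
                           (P? (node A (node B r)))

anyLeftRotation? : {P : Pred Tree p} → Decidable P →
                   ∀ S → Dec (∃[ S′ ] RightRotation S′ S × P S′)
anyLeftRotation? P? leaf       = no λ ()
anyLeftRotation? {P = P} P? (node l r) =
  map′ (λ { (inj₁ (_ , refl , x))      → _ , rotate , x
          ; (inj₂ (inj₁ (_ , ρ , x))) → _ , left ρ , x
          ; (inj₂ (inj₂ (_ , ρ , x))) → _ , right ρ , x })
       (λ { (_ , rotate  , x) → inj₁ (_ , refl , x)
          ; (_ , left ρ  , x) → inj₂ (inj₁ (_ , ρ , x))
          ; (_ , right ρ , x) → inj₂ (inj₂ (_ , ρ , x)) })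
       (atRoot r
        ⊎-dec anyLeftRotation? (λ l′ → P? (node l′ r)) l
        ⊎-dec anyLeftRotation? (λ r′ → P? (node l r′)) r)
  where
  atRoot : ∀ r → Dec (Σ (Tree × Tree) λ (B , C) →
                      r ≡ node B C × P (node (node l B) C))
  atRoot leaf       = no λ ()
  atRoot (node B C) = map′ (λ x → _ , refl , x) (λ { (_ , refl , x) → x })
                           (P? (node (node l B) C))

rotations? : ∀ S T d → Dec (Rotations d S T)
rotations? S T zero    = map′ (λ { refl → [] }) (λ { [] → refl }) (S ≟ T)
rotations? S T (suc d) =
  map′ (λ { (inj₁ (_ , ρ , ρs)) → fwd ρ ∷ ρs
          ; (inj₂ (_ , ρ , ρs)) → bwd ρ ∷ ρs })
       (λ { (fwd ρ ∷ ρs) → inj₁ (_ , ρ , ρs)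
          ; (bwd ρ ∷ ρs) → inj₂ (_ , ρ , ρs) })
       (anyRightRotation? (λ S′ → rotations? S′ T d) S
        ⊎-dec anyLeftRotation? (λ S′ → rotations? S′ T d) S)

rightComb : ℕ → Tree
rightComb zero    = leaf
rightComb (suc n) = node leaf (rightComb n)

joinCombs : ∀ m n → EqClosure RightRotation
            (node (rightComb m) (rightComb n)) (rightComb (suc (m + n)))
joinCombs zero    n = ε
joinCombs (suc m) n =
  fwd rotate ◅ EqClosure.gmap (node leaf) right (joinCombs m n)

toRightComb : ∀ t → EqClosure RightRotation t (rightComb (interior t))
toRightComb leaf       = ε
toRightComb (node l r) =
  EqClosure.gmap (λ l′ → node l′ r) left (toRightComb l) ◅◅
  EqClosure.gmap (node _) right (toRightComb r) ◅◅
  joinCombs (interior l) (interior r)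

connected : ∀ S T → leaves S ≡ leaves T → ∃[ d ] Rotations d S T
connected S T eq = count (toRightComb S ◅◅ EqClosure.symmetric _ T→comb)
  where
  count : ∀ {S T} → EqClosure RightRotation S T → ∃[ d ] Rotations d S T
  count ε        = 0 , []
  count (ρ ◅ ρs) = let d , ρs′ = count ρs in suc d , ρ ∷ ρs′

  interior-≡ : interior T ≡ interior S
  interior-≡ = suc-injective
    (trans (sym (leaves≡suc-interior T))
           (trans (sym eq) (leaves≡suc-interior S)))

  T→comb : EqClosure RightRotation T (rightComb (interior S))
  T→comb = subst (EqClosure RightRotation T ∘ rightComb) interior-≡
                 (toRightComb T)

module _ (S T : Tree) (eq : leaves S ≡ leaves T) where

  private
    minimum : ∃ (IsLeast (λ d → Rotations d S T))
    minimum = least (rotations? S T) (connected S T eq)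

  rotationDistance : ℕ
  rotationDistance = proj₁ minimum

  rotationDistance-isLeast : IsLeast (λ d → Rotations d S T) rotationDistance
  rotationDistance-isLeast = proj₂ minimum

{-# OPTIONS --safe #-}
module Submission where

open import Defs
open import Data.Bool.Base using (Bool; true; false)
open import Data.Empty using (⊥; ⊥-elim)
open import Data.Integer using (+_; _-_; _*_; _≤_; +≤+) renaming (_+_ to _+ℤ_)
open import Data.Integer.Properties using (pos-*)
open import Data.Integer.Tactic.RingSolver using (solve-∀)
open import Data.List.Base using (List; []; _∷_; _++_; map; filter; length; replicate)
open import Data.List.Membership.Propositional using (_∈_; lose; find)
open import Data.List.Membership.Propositional.Properties
  using (∈-++⁺ˡ; ∈-++⁺ʳ; ∈-++⁻; ∈-filter⁺; ∈-filter⁻; ∈-map⁺; ∈-map⁻)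
open import Data.List.Membership.Propositional.Properties.WithK using (unique∧set⇒bag)
open import Data.List.Properties
  using (length-++; filter-++; filter-accept; filter-none; map-++; map-∘; map-id;
         ++-assoc; ++-identityʳ; ∷-injectiveʳ)
open import Data.List.Relation.Binary.BagAndSetEquality using (∼bag⇒↭)
open import Data.List.Relation.Binary.Permutation.Propositional
  using (_↭_; prep; swap; ↭-sym; ↭-trans; ↭-refl; ↭-reflexive)
open import Data.List.Relation.Binary.Permutation.Propositional.Properties
  using (↭-length; filter-↭; ∈-resp-↭; shift; ++⁺ˡ; ++⁺ʳ)
import Data.List.Relation.Unary.All as All
open import Data.List.Relation.Unary.AllPairs using ([]; _∷_)
open import Data.List.Relation.Unary.Any using (here; there)
open import Data.List.Relation.Unary.Unique.Propositional using (Unique)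
open import Data.List.Relation.Unary.Unique.Propositional.Properties
  using () renaming (++⁺ to Unique-++⁺; filter⁺ to Unique-filter⁺)
open import Data.Nat.Base as ℕ using (ℕ; zero; suc; z≤n; s≤s; _∸_)
  renaming (_+_ to _∔_; _≤_ to _≤ℕ_)
open import Data.Nat.Properties as ℕ
  using (≤-refl; ≤-reflexive; ≤-trans; ≤-antisym; ≤-<-trans; <-≤-trans; <-irrefl; <⇒≢; <⇒≱;
         ≮⇒≥; n≤1+n; m≤m+n; m<m+n; m<n+m; +-mono-≤; +-monoˡ-≤; +-monoʳ-≤; +-cancelˡ-≤;
         +-cancelˡ-≡; +-assoc; +-comm; +-suc; +-identityʳ; m+n∸m≡n; suc-injective;
         module ≤-Reasoning)
open import Data.Product using (_×_; _,_; proj₁; proj₂; ∃-syntax)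
open import Data.Product.Properties using (≡-dec)
open import Data.List.Membership.DecPropositional (≡-dec ℕ._≟_ ℕ._≟_) using (_∈?_)
open import Data.Sum.Base using (_⊎_; inj₁; inj₂)
import Data.Vec.Base as Vec
import Data.Vec.Properties as Vec
open import Function.Base using (_∘_; id)
open import Function.Bundles using (_⇔_; mk⇔; Equivalence)
open import Level using (0ℓ)
open import Relation.Binary.Construct.Closure.Symmetric as Sym using (fwd; bwd)
open import Relation.Binary.PropositionalEquality
  using (_≡_; _≢_; refl; sym; trans; cong; cong₂; subst; module ≡-Reasoning)
open import Relation.Nullary.Decidable using (yes; no; ¬?; _×-dec_)
open import Relation.Nullary.Negation using (¬_; contradiction)
open import Relation.Unary using (Pred; Decidable)

-- Identify an interior node with the interval of leaves below it, and let
-- D be the number of intervals of S that are not intervals of T.  Counting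
-- the root as common, n = e + 1 + D.
--
-- Lower bound: a rotation exchanges one interval for another, so it changes
-- the number of intervals missing from T by at most one.
--
-- Upper bound: mark the intervals common to S and T.  Walking down the right
-- spine of S and rotating away every unmarked left child leads, with at most
-- one rotation per unmarked interval, to a tree that has all marked intervals
-- and whose interior left children are all marked.  There is only one such
-- tree, so S and T meet there after at most D rotations each.

-- Counting the entries of a list that satisfy a predicate.

module _ {A : Set} {P : Pred A 0ℓ} (P? : Decidable P) where

  count : List A → ℕ
  count xs = length (filter P? xs)

  count-++ : ∀ xs ys → count (xs ++ ys) ≡ count xs ∔ count ys
  count-++ xs ys = trans (cong length (filter-++ P? xs ys)) (length-++ (filter P? xs))

  count-↭ : ∀ {xs ys} → xs ↭ ys → count xs ≡ count ys
  count-↭ = ↭-length ∘ filter-↭ P?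

  count-∷-≤ : ∀ x xs → count (x ∷ xs) ≤ℕ suc (count xs)
  count-∷-≤ x xs with P? x
  ... | yes _ = ≤-refl
  ... | no  _ = n≤1+n _

  count-≤-∷ : ∀ x xs → count xs ≤ℕ count (x ∷ xs)
  count-≤-∷ x xs with P? x
  ... | yes _ = n≤1+n _
  ... | no  _ = ≤-refl

  count+count-¬ : ∀ xs → count xs ∔ length (filter (¬? ∘ P?) xs) ≡ length xs
  count+count-¬ []       = refl
  count+count-¬ (x ∷ xs) with P? x
  ... | yes _ = cong suc (count+count-¬ xs)
  ... | no  _ = trans (+-suc _ _) (cong suc (count+count-¬ xs))

-- The equivalence is required on members of `xs` only: `unmarked-S` uses membership in the spans of
-- `S` to identify "not common" with "not in `T`".
count-map : {A B : Set} {P : Pred A 0ℓ} {Q : Pred B 0ℓ} (P? : Decidable P) (Q? : Decidable Q)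
            (f : A → B) (xs : List A) → (∀ {x} → x ∈ xs → P x ⇔ Q (f x)) →
            count P? xs ≡ count Q? (map f xs)
count-map P? Q? f []       P⇔Q = refl
count-map P? Q? f (x ∷ xs) P⇔Q with P? x | Q? (f x) | count-map P? Q? f xs (P⇔Q ∘ there)
... | yes _ | yes _ | ih = cong suc ih
... | no  _ | no  _ | ih = ih
... | yes p | no ¬q | _  = contradiction (Equivalence.to (P⇔Q (here refl)) p) ¬q
... | no ¬p | yes q | _  = contradiction (Equivalence.from (P⇔Q (here refl)) q) ¬p

-- After filtering, both lists are duplicate-free with the same members, hence permutations of each
-- other. This makes the number of common spans symmetric in the two trees.
count-unique : {A : Set} {P : Pred A 0ℓ} (P? : Decidable P) {xs ys : List A} →
               Unique xs → Unique ys →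
               (∀ {x} → P x → x ∈ xs) → (∀ {x} → P x → x ∈ ys) →
               count P? xs ≡ count P? ys
count-unique P? {xs} {ys} uxs uys ⊆xs ⊆ys = ↭-length (∼bag⇒↭
  (unique∧set⇒bag (Unique-filter⁺ P? uxs) (Unique-filter⁺ P? uys)
    (mk⇔ (λ x∈ → let px = proj₂ (∈-filter⁻ P? {xs = xs} x∈) in ∈-filter⁺ P? (⊆ys px) px)
         (λ x∈ → let px = proj₂ (∈-filter⁻ P? {xs = ys} x∈) in ∈-filter⁺ P? (⊆xs px) px))))

-- Trees as families of spans of leaves.

-- The leaves below a node are consecutive: (a , s) stands for the s leaves
-- a, …, a + s - 1.
Span : Set
Span = ℕ × ℕ

spans : ℕ → Tree → List Span
spans i leaf       = []
spans i (node l r) = (i , leaves l ∔ leaves r) ∷ spans i l ++ spans (i ∔ leaves l) r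

length-spans : ∀ i t → length (spans i t) ≡ interior t
length-spans i leaf       = refl
length-spans i (node l r) = cong suc (trans (length-++ (spans i l))
  (cong₂ _∔_ (length-spans i l) (length-spans (i ∔ leaves l) r)))

0<leaves : ∀ t → 0 ℕ.< leaves t
0<leaves leaf       = s≤s z≤n
0<leaves (node l r) = ≤-trans (0<leaves l) (m≤m+n _ _)

-- The field `size` excludes empty spans: one placed at the border of two adjacent ranges would lie
-- within both, and `within-disjoint` would fail.
record Within (i n : ℕ) (x : Span) : Set where
  constructor within
  field
    start : i ≤ℕ proj₁ x
    size  : 0 ℕ.< proj₂ x
    end   : proj₁ x ∔ proj₂ x ≤ℕ i ∔ n

within-left : ∀ {i m x} n → Within i m x → Within i (m ∔ n) x
within-left {i} n (within p q r) = within p q (≤-trans r (+-monoʳ-≤ i (m≤m+n _ n)))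

within-right : ∀ {i n x} m → Within (i ∔ m) n x → Within i (m ∔ n) x
within-right {i} {n} m (within p q r) =
  within (≤-trans (m≤m+n i m) p) q (≤-trans r (≤-reflexive (+-assoc i m n)))

span-within : ∀ i t {x} → x ∈ spans i t → Within i (leaves t) x
span-within i (node l r) (here refl) = within ≤-refl (0<leaves (node l r)) ≤-refl
span-within i (node l r) (there x∈) with ∈-++⁻ (spans i l) x∈
... | inj₁ x∈l = within-left (leaves r) (span-within i l x∈l)
... | inj₂ x∈r = within-right (leaves l) (span-within (i ∔ leaves l) r x∈r)

within-size : ∀ {i a s n} → Within i n (a , s) → s ≤ℕ n
within-size {i} (within p _ r) = +-cancelˡ-≤ i _ _ (≤-trans (+-monoˡ-≤ _ p) r)

within-disjoint : ∀ {i m n x} → Within i m x → Within (i ∔ m) n x → ⊥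
within-disjoint {x = a , s} (within _ q r) (within p _ _) =
  <-irrefl refl (<-≤-trans (m<m+n a q) (≤-trans r p))

module _ (l r : Tree) where

  leaves-left-< : leaves l ℕ.< leaves l ∔ leaves r
  leaves-left-< = m<m+n _ (0<leaves r)

  leaves-right-< : leaves r ℕ.< leaves l ∔ leaves r
  leaves-right-< = m<n+m _ (0<leaves l)

  span-of-child-< : ∀ {i a s} → (a , s) ∈ spans i l ++ spans (i ∔ leaves l) r →
                    s ℕ.< leaves l ∔ leaves r
  span-of-child-< {i} x∈ with ∈-++⁻ (spans i l) x∈
  ... | inj₁ x∈l = ≤-<-trans (within-size (span-within i l x∈l)) leaves-left-<
  ... | inj₂ x∈r = ≤-<-trans (within-size (span-within _ r x∈r)) leaves-right-<

  -- The root span is too long to fit and the spans of `r` lie elsewhere. With `span∈right`, this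
  -- passes the containment hypotheses of `Normal-unique` down to the subtrees.
  span∈left : ∀ {i x} → x ∈ spans i (node l r) → Within i (leaves l) x → x ∈ spans i l
  span∈left (here refl) w = contradiction (within-size w) (<⇒≱ leaves-left-<)
  span∈left {i} (there x∈) w with ∈-++⁻ (spans i l) x∈
  ... | inj₁ x∈l = x∈l
  ... | inj₂ x∈r = ⊥-elim (within-disjoint w (span-within _ r x∈r))

  span∈right : ∀ {i x} → x ∈ spans i (node l r) → Within (i ∔ leaves l) (leaves r) x →
               x ∈ spans (i ∔ leaves l) r
  span∈right (here refl) w = contradiction (within-size w) (<⇒≱ leaves-right-<)
  span∈right {i} (there x∈) w with ∈-++⁻ (spans i l) x∈
  ... | inj₁ x∈l = ⊥-elim (within-disjoint (span-within i l x∈l) w)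
  ... | inj₂ x∈r = x∈r

-- The root span is strictly longer than every other one, and the spans of the two children occupy
-- disjoint ranges.
spans-unique : ∀ i t → Unique (spans i t)
spans-unique i leaf       = []
spans-unique i (node l r) =
  All.tabulate (λ x∈ eq → <⇒≢ (span-of-child-< l r x∈) (sym (cong proj₂ eq))) ∷
  Unique-++⁺ (spans-unique i l) (spans-unique _ r)
    (λ (x∈l , x∈r) → within-disjoint (span-within i l x∈l) (span-within _ r x∈r))

-- Rotations and spans

rotation-leaves : ∀ {S S′} → RightRotation S S′ → leaves S ≡ leaves S′
rotation-leaves (rotate {A} {B} {C}) = +-assoc (leaves A) (leaves B) (leaves C)
rotation-leaves (left {r = r} ρ)     = cong (_∔ leaves r) (rotation-leaves ρ)
rotation-leaves (right {l = l} ρ)    = cong (leaves l ∔_) (rotation-leaves ρ)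

module _ (i : ℕ) (A B C : Tree) where

  private
    a b c : ℕ
    a = leaves A
    b = leaves B
    c = leaves C

  -- The offsets are those of `node A (node B C)`, so only `rotate-spansˡ` has to reassociate sums.
  keptSpans : List Span
  keptSpans = (i , a ∔ (b ∔ c)) ∷ spans i A ++ spans (i ∔ a) B ++ spans (i ∔ a ∔ b) C

  rotate-spansˡ : spans i (node (node A B) C) ↭ (i , a ∔ b) ∷ keptSpans
  rotate-spansˡ = ↭-trans (↭-reflexive (cong₂ _∷_ (cong (i ,_) (+-assoc a b c))
      (cong ((i , a ∔ b) ∷_)
        (trans (cong (λ j → (spans i A ++ spans (i ∔ a) B) ++ spans j C) (sym (+-assoc i a b)))
               (++-assoc (spans i A) _ _)))))
    (swap _ _ ↭-refl)

  rotate-spansʳ : spans i (node A (node B C)) ↭ (i ∔ a , b ∔ c) ∷ keptSpans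
  rotate-spansʳ = ↭-trans (prep _ (shift _ (spans i A) _)) (swap _ _ ↭-refl)

-- Only the lower endpoint of the rotated edge changes its leaf set: `A` and `B` together give way
-- to `B` and `C` together. Every other span, inside or outside the rotated subtree, goes into `zs`.
rotation-spans : ∀ i {S S′} → RightRotation S S′ →
                 ∃[ x ] ∃[ y ] ∃[ zs ] spans i S ↭ x ∷ zs × spans i S′ ↭ y ∷ zs
rotation-spans i (rotate {A} {B} {C}) =
  _ , _ , _ , rotate-spansˡ i A B C , rotate-spansʳ i A B C
rotation-spans i (left {r = r} ρ) =
  let x , y , zs , p , q = rotation-spans i ρ in
  x , y , _ , ↭-trans (prep _ (++⁺ʳ _ p)) (swap _ _ ↭-refl) ,
  -- The root size and the offset of `r` in the new tree mention the rotated child. They are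
  -- rewritten to the old child's leaf count, so that one `zs` serves both trees.
  ↭-trans (↭-reflexive (cong (λ n → (i , n ∔ leaves r) ∷ _ ++ spans (i ∔ n) r)
                             (sym (rotation-leaves ρ))))
          (↭-trans (prep _ (++⁺ʳ _ q)) (swap _ _ ↭-refl))
rotation-spans i (right {l = l} ρ) =
  let x , y , zs , p , q = rotation-spans (i ∔ leaves l) ρ in
  x , y , _ , ↭-trans (prep _ (↭-trans (++⁺ˡ _ p) (shift x (spans i l) zs))) (swap _ _ ↭-refl) ,
  ↭-trans (↭-reflexive (cong (λ n → (i , leaves l ∔ n) ∷ _) (sym (rotation-leaves ρ))))
          (↭-trans (prep _ (↭-trans (++⁺ˡ _ q) (shift y (spans i l) zs))) (swap _ _ ↭-refl))

rotation-count : {P : Pred Span 0ℓ} (P? : Decidable P) → ∀ i {S S′} → Rotation S S′ →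
                 count P? (spans i S) ≤ℕ suc (count P? (spans i S′))
rotation-count P? i {S} {S′} ρ = exchange (spans↭ ρ)
  where
  spans↭ : ∀ {S S′} → Rotation S S′ →
           ∃[ x ] ∃[ y ] ∃[ zs ] spans i S ↭ x ∷ zs × spans i S′ ↭ y ∷ zs
  spans↭ (fwd ρ) = rotation-spans i ρ
  spans↭ (bwd ρ) = let x , y , zs , p , q = rotation-spans i ρ in y , x , zs , q , p

  exchange : (∃[ x ] ∃[ y ] ∃[ zs ] spans i S ↭ x ∷ zs × spans i S′ ↭ y ∷ zs) →
             count P? (spans i S) ≤ℕ suc (count P? (spans i S′))
  exchange (x , y , zs , p , q) = begin
    count P? (spans i S)        ≡⟨ count-↭ P? p ⟩
    count P? (x ∷ zs)           ≤⟨ count-∷-≤ P? x zs ⟩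
    suc (count P? zs)           ≤⟨ s≤s (count-≤-∷ P? y zs) ⟩
    suc (count P? (y ∷ zs))     ≡⟨ cong suc (count-↭ P? q) ⟨
    suc (count P? (spans i S′)) ∎
    where open ≤-Reasoning

rotations-count : {P : Pred Span 0ℓ} (P? : Decidable P) → ∀ i {d S T} → Rotations d S T →
                  count P? (spans i S) ≤ℕ d ∔ count P? (spans i T)
rotations-count P? i []       = ≤-refl
rotations-count P? i (ρ ∷ ρs) =
  ≤-trans (rotation-count P? i ρ) (s≤s (rotations-count P? i ρs))

-- Sequences of rotations.

infixr 5 _++ᴿ_

_++ᴿ_ : ∀ {d e S T U} → Rotations d S T → Rotations e T U → Rotations (d ∔ e) S U
[]       ++ᴿ σs = σs
(ρ ∷ ρs) ++ᴿ σs = ρ ∷ (ρs ++ᴿ σs)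

reverseᴿ : ∀ {d S T} → Rotations d S T → Rotations d T S
reverseᴿ []                 = []
reverseᴿ {T = T} (_∷_ {d} {S} ρ ρs) =
  subst (λ k → Rotations k T S) (+-comm d 1) (reverseᴿ ρs ++ᴿ Sym.symmetric _ ρ ∷ [])

mapᴿ : (f : Tree → Tree) → (∀ {S T} → RightRotation S T → RightRotation (f S) (f T)) →
       ∀ {d S T} → Rotations d S T → Rotations d (f S) (f T)
mapᴿ f g []       = []
mapᴿ f g (ρ ∷ ρs) = Sym.gmap f g ρ ∷ mapᴿ f g ρs

-- Normal forms relative to a set `M` of marked spans.

module _ {M : Pred Span 0ℓ} where

  -- Only left children are constrained. If nothing is marked, the normal trees are exactly the
  -- right combs.
  data Normal (i : ℕ) : Tree → Set where
    leaf : Normal i leaf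
    node : ∀ {l r} → l ≡ leaf ⊎ M (i , leaves l) →
           Normal i l → Normal (i ∔ leaves l) r → Normal i (node l r)

  -- The marks determine the size of the left subtree: it is the length of the longest marked span
  -- that starts at `i` and is shorter than the whole tree, or 1 if there is none. Equal sizes on
  -- the left give equal sizes on the right, and induction applies to both children.
  Normal-unique : ∀ {i S T} → Normal i S → Normal i T → leaves S ≡ leaves T →
                  (∀ {x} → M x → Within i (leaves S) x → x ∈ spans i S) →
                  (∀ {x} → M x → Within i (leaves T) x → x ∈ spans i T) →
                  S ≡ T
  Normal-unique leaf leaf eq S∋ T∋ = refl
  Normal-unique leaf (node {l} {r} _ _ _) eq S∋ T∋ =
    contradiction eq (<⇒≢ (≤-<-trans (0<leaves l) (leaves-left-< l r)))
  Normal-unique (node {l} {r} _ _ _) leaf eq S∋ T∋ =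
    contradiction (sym eq) (<⇒≢ (≤-<-trans (0<leaves l) (leaves-left-< l r)))
  Normal-unique {i} (node {l} {r} ml nl nr) (node {l′} {r′} ml′ nl′ nr′) eq S∋ T∋ =
    cong₂ node l≡ r≡
    where
    -- If l′ is longer than l, then its span lies strictly between those of l
    -- and the root, so it cannot be a span of node l r.
    not-longer : ∀ {l r l′ r′} → leaves l ∔ leaves r ≡ leaves l′ ∔ leaves r′ →
                 l′ ≡ leaf ⊎ M (i , leaves l′) →
                 (∀ {x} → M x → Within i (leaves l ∔ leaves r) x → x ∈ spans i (node l r)) →
                 leaves l ℕ.< leaves l′ → ⊥
    not-longer {l} _ (inj₁ refl) _ l<l′ = <⇒≱ l<l′ (0<leaves l)
    not-longer {l} {r} {l′} {r′} eq (inj₂ m) S∋ l<l′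
      with S∋ m (subst (λ n → Within i n (i , leaves l′)) (sym eq)
                  (within-left (leaves r′) (within ≤-refl (0<leaves l′) ≤-refl)))
    ... | here x≡ = <⇒≢ (leaves-left-< l′ r′) (trans (cong proj₂ x≡) eq)
    ... | there x∈ with ∈-++⁻ (spans i l) x∈
    ...   | inj₁ x∈l = <⇒≱ l<l′ (within-size (span-within i l x∈l))
    ...   | inj₂ x∈r = <⇒≱ (m<m+n i (0<leaves l)) (Within.start (span-within _ r x∈r))

    leaves-l : leaves l ≡ leaves l′
    leaves-l = ≤-antisym (≮⇒≥ (not-longer {l′} {r′} {l} {r} (sym eq) ml T∋))
                         (≮⇒≥ (not-longer {l} {r} {l′} {r′} eq ml′ S∋))

    leaves-r : leaves r ≡ leaves r′
    leaves-r = +-cancelˡ-≡ (leaves l) _ _ (trans eq (cong (_∔ leaves r′) (sym leaves-l)))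

    l≡ : l ≡ l′
    l≡ = Normal-unique nl nl′ leaves-l
      (λ m w → span∈left l r (S∋ m (within-left (leaves r) w)) w)
      (λ m w → span∈left l′ r′ (T∋ m (within-left (leaves r′) w)) w)

    r≡ : r ≡ r′
    r≡ = Normal-unique nr (subst (λ n → Normal (i ∔ n) r′) (sym leaves-l) nr′) leaves-r
      (λ m w → span∈right l r (S∋ m (within-right (leaves l) w)) w)
      (λ {x} m w → subst (λ n → x ∈ spans (i ∔ n) r′) (sym leaves-l)
        (let w′ = subst (λ n → Within (i ∔ n) (leaves r′) x) leaves-l w in
         span∈right l′ r′ (T∋ m (within-right (leaves l′) w′)) w′))

  -- Here `k` is a budget, not an exact length, so estimates can be weakened freely. The field
  -- `leaves≡` is carried along because the offset of every subtree further right depends on it.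
  record Reduces (i k : ℕ) (S R : Tree) : Set where
    field
      {steps}   : ℕ
      steps≤    : steps ≤ℕ k
      rotations : Rotations steps S R
      leaves≡   : leaves S ≡ leaves R
      keeps     : ∀ {x} → M x → x ∈ spans i S → x ∈ spans i R

  open Reduces

  module _ {i : ℕ} where

    Reduces-refl : ∀ {S} → Reduces i 0 S S
    Reduces-refl = record { steps≤ = z≤n ; rotations = [] ; leaves≡ = refl ; keeps = λ _ → id }

    Reduces-trans : ∀ {j k S T U} → Reduces i j S T → Reduces i k T U → Reduces i (j ∔ k) S U
    Reduces-trans p q = record
      { steps≤    = +-mono-≤ (steps≤ p) (steps≤ q)
      ; rotations = rotations p ++ᴿ rotations q
      ; leaves≡   = trans (leaves≡ p) (leaves≡ q)
      ; keeps     = λ m → keeps q m ∘ keeps p m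
      }

    Reduces-≤ : ∀ {j k S T} → j ≤ℕ k → Reduces i j S T → Reduces i k S T
    Reduces-≤ j≤k p = record
      { steps≤ = ≤-trans (steps≤ p) j≤k ; rotations = rotations p
      ; leaves≡ = leaves≡ p ; keeps = keeps p }

    Reduces-left : ∀ {k l l′ r} → Reduces i k l l′ → Reduces i k (node l r) (node l′ r)
    Reduces-left {l = l} {l′} {r} p = record
      { steps≤    = steps≤ p
      ; rotations = mapᴿ (λ t → node t r) left (rotations p)
      ; leaves≡   = cong (_∔ leaves r) (leaves≡ p)
      ; keeps     = kept
      }
      where
      kept : ∀ {x} → M x → x ∈ spans i (node l r) → x ∈ spans i (node l′ r)
      kept m (here refl) = here (cong (λ n → i , n ∔ leaves r) (leaves≡ p))
      kept {x} m (there x∈) with ∈-++⁻ (spans i l) x∈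
      ... | inj₁ x∈l = there (∈-++⁺ˡ (keeps p m x∈l))
      ... | inj₂ x∈r = there (∈-++⁺ʳ (spans i l′)
                         (subst (λ n → x ∈ spans (i ∔ n) r) (leaves≡ p) x∈r))

    Reduces-right : ∀ {k l r r′} → Reduces (i ∔ leaves l) k r r′ →
                    Reduces i k (node l r) (node l r′)
    Reduces-right {l = l} {r} {r′} p = record
      { steps≤    = steps≤ p
      ; rotations = mapᴿ (node l) right (rotations p)
      ; leaves≡   = cong (leaves l ∔_) (leaves≡ p)
      ; keeps     = kept
      }
      where
      kept : ∀ {x} → M x → x ∈ spans i (node l r) → x ∈ spans i (node l r′)
      kept m (here refl) = here (cong (λ n → i , leaves l ∔ n) (leaves≡ p))
      kept m (there x∈) with ∈-++⁻ (spans i l) x∈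
      ... | inj₁ x∈l = there (∈-++⁺ˡ x∈l)
      ... | inj₂ x∈r = there (∈-++⁺ʳ (spans i l) (keeps p m x∈r))

    -- The one span that the rotation destroys is that of `node A B`, which is unmarked.
    Reduces-rotate : ∀ {A B C} → ¬ M (i , leaves (node A B)) →
                     Reduces i 1 (node (node A B) C) (node A (node B C))
    Reduces-rotate {A} {B} {C} ¬m = record
      { steps≤    = ≤-refl
      ; rotations = fwd rotate ∷ []
      ; leaves≡   = +-assoc (leaves A) (leaves B) (leaves C)
      ; keeps     = λ m x∈ → ∈-resp-↭ (↭-sym (rotate-spansʳ i A B C))
                      (there (kept m (∈-resp-↭ (rotate-spansˡ i A B C) x∈)))
      }
      where
      kept : ∀ {x xs} → M x → x ∈ (i , leaves (node A B)) ∷ xs → x ∈ xs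
      kept m (here refl) = contradiction m ¬m
      kept m (there x∈)  = x∈

  -- The normalisation procedure and its cost.

  module _ (M? : Decidable M) where

    unmarked : ℕ → Tree → ℕ
    unmarked i t = count (¬? ∘ M?) (spans i t)

    unmarked-children : ∀ i l r → unmarked i l ∔ unmarked (i ∔ leaves l) r ≤ℕ unmarked i (node l r)
    unmarked-children i l r = ≤-trans (≤-reflexive (sym (count-++ (¬? ∘ M?) (spans i l) _)))
                                      (count-≤-∷ (¬? ∘ M?) (i , leaves (node l r)) _)

    -- The budget omits the span of `node A B` itself: the root of the tree being normalised is
    -- never rotated away as a left child. This lets `attach` treat marked subtrees at no cost for
    -- their roots.
    normalise : ∀ i A B → ∃[ R ] Normal i R ×
                Reduces i (unmarked i A ∔ unmarked (i ∔ leaves A) B) (node A B) R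

    -- With a normal right subtree `U` already in place, it remains to clean up the left child `t`.
    -- Each rotation is charged to a different unmarked span of `t`.
    attach : ∀ i t {U} → Normal (i ∔ leaves t) U →
             ∃[ R ] Normal i R × Reduces i (unmarked i t) (node t U) R

    normalise i A leaf =
      let R , nR , p = attach i A leaf in R , nR , Reduces-≤ (m≤m+n _ _) p
    normalise i A (node B C) =
      let R , nR , p = normalise (i ∔ leaves A) B C
          Q , nQ , q = attach i A nR
      -- The stated budget includes the span of `node B C` if it is unmarked; the recursive call
      -- does not spend it.
      in Q , nQ , Reduces-≤ (≤-trans (+-monoˡ-≤ _ (unmarked-children (i ∔ leaves A) B C))
                                     (≤-reflexive (+-comm _ (unmarked i A))))
                            (Reduces-trans (Reduces-right p) q)

    attach i leaf nU = _ , node (inj₁ refl) leaf nU , Reduces-refl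
    attach i (node A B) {U} nU with M? (i , leaves (node A B))
    -- A marked subtree stays a left child and is normalised in place. Its own span is absent from
    -- the budget, which therefore agrees with that of `normalise`.
    ... | yes m =
      let R , nR , p = normalise i A B
          size       = leaves≡ p
      in _ , node (inj₂ (subst (λ n → M (i , n)) size m)) nR
                  (subst (λ n → Normal (i ∔ n) U) size nU)
           , Reduces-≤ (≤-reflexive (sym (count-++ (¬? ∘ M?) (spans i A) _))) (Reduces-left p)
    -- The unmarked span of `node A B` pays for one rotation to `node A (node B U)`. Then `B` is
    -- attached to `U`, and `A` to the outcome.
    ... | no ¬m =
      let R , nR , p = attach (i ∔ leaves A) B
                         (subst (λ j → Normal j U) (sym (+-assoc i (leaves A) (leaves B))) nU)
          Q , nQ , q = attach i A nR
      in Q , nQ , Reduces-≤ (≤-reflexive (trans (cong suc (+-comm _ (unmarked i A)))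
                                                (cong suc (sym (count-++ (¬? ∘ M?) (spans i A) _)))))
                            (Reduces-trans (Reduces-rotate ¬m)
                              (Reduces-trans (Reduces-right p) q))

-- Leaf sets of edges as spans

spanOf : ∀ i {t} → InteriorNode t → Span
spanOf i {t} root          = i , leaves t
spanOf i (left v)          = spanOf i v
spanOf i (right {l = l} v) = spanOf (i ∔ leaves l) v

map-spanOf : ∀ i t → map (spanOf i) (interiorNodes t) ≡ spans i t
map-spanOf i leaf       = refl
map-spanOf i (node l r) = cong ((i , leaves (node l r)) ∷_) (trans
  (map-++ (spanOf i) (map left (interiorNodes l)) _)
  (cong₂ _++_ (trans (sym (map-∘ (interiorNodes l))) (map-spanOf i l))
              (trans (sym (map-∘ (interiorNodes r))) (map-spanOf (i ∔ leaves l) r))))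

lowerEndpoint : ∀ {t} → InternalEdge t → InteriorNode t
lowerEndpoint (left v)  = left v
lowerEndpoint (right v) = right v

edgeSpan : ∀ {t} → InternalEdge t → Span
edgeSpan = spanOf 0 ∘ lowerEndpoint

leavesBelow-lowerEndpoint : ∀ {t} (e : InternalEdge t) →
                            leavesBelow e ≡ leavesBelowNode (lowerEndpoint e)
leavesBelow-lowerEndpoint (left v)  = refl
leavesBelow-lowerEndpoint (right v) = refl

map-edgeSpan : ∀ l r → map edgeSpan (internalEdges (node l r)) ≡
               spans 0 l ++ spans (leaves l) r
map-edgeSpan l r = trans
  (map-++ edgeSpan (map left (interiorNodes l)) _)
  (cong₂ _++_ (trans (sym (map-∘ (interiorNodes l))) (map-spanOf 0 l))
              (trans (sym (map-∘ (interiorNodes r))) (map-spanOf (leaves l) r)))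

-- The characteristic list of the span `(a , s)` with `q` leaves after it. Plain lists allow subsets
-- of the leaves of different trees to be compared without casts.
block : ℕ → ℕ → ℕ → List Bool
block a s q = replicate a false ++ replicate s true ++ replicate q false

replicate-+ : ∀ {A : Set} m n (x : A) → replicate (m ∔ n) x ≡ replicate m x ++ replicate n x
replicate-+ zero    n x = refl
replicate-+ (suc m) n x = cong (x ∷_) (replicate-+ m n x)

-- The leading run of `false` has length `a`, and the run of `true` after it has length `s`.
-- Positivity matters: an empty run of `true` would merge the two paddings and lose `a`.
block-injective : ∀ {a a′ s s′ q q′} → 0 ℕ.< s → 0 ℕ.< s′ →
                  block a s q ≡ block a′ s′ q′ → (a , s) ≡ (a′ , s′)
block-injective {zero}  {zero}   {s} {s′}    p p′ eq = cong (0 ,_) (run s s′ eq)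
  where
  run : ∀ s s′ {q q′} → replicate s true ++ replicate q false ≡
                        replicate s′ true ++ replicate q′ false → s ≡ s′
  run zero    zero     eq = refl
  run (suc s) (suc s′) eq = cong suc (run s s′ (∷-injectiveʳ eq))
  run zero    (suc s′) {zero}  ()
  run zero    (suc s′) {suc _} ()
  run (suc s) zero     {q′ = zero}  ()
  run (suc s) zero     {q′ = suc _} ()
block-injective {zero}  {suc a′} (s≤s _) p′ ()
block-injective {suc a} {zero}   p (s≤s _) ()
block-injective {suc a} {suc a′} p p′ eq =
  cong (λ (a , s) → suc a , s) (block-injective {a} {a′} p p′ (∷-injectiveʳ eq))

-- The paddings i and j make the statement closed under descending into a subtree.
leavesBelowNode-block : ∀ i j {t} (v : InteriorNode t) → let (a , s) = spanOf i v in
  replicate i false ++ Vec.toList (leavesBelowNode v) ++ replicate j false ≡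
  block a s (i ∔ leaves t ∔ j ∸ (a ∔ s))
leavesBelowNode-block i j {t} root =
  cong (replicate i false ++_) (cong₂ _++_ (Vec.toList-replicate (leaves t) true)
    (cong (λ n → replicate n false) (sym (m+n∸m≡n (i ∔ leaves t) j))))
leavesBelowNode-block i j {node l r} (left v) = begin
  replicate i false ++ Vec.toList (leavesBelowNode v Vec.++ Vec.replicate (leaves r) false) ++ replicate j false
    ≡⟨ cong (λ xs → replicate i false ++ xs ++ replicate j false)
         (trans (Vec.toList-++ (leavesBelowNode v) _)
                (cong (Vec.toList (leavesBelowNode v) ++_) (Vec.toList-replicate (leaves r) false))) ⟩
  replicate i false ++ (Vec.toList (leavesBelowNode v) ++ replicate (leaves r) false) ++ replicate j false
    ≡⟨ cong (replicate i false ++_) (trans (++-assoc (Vec.toList (leavesBelowNode v)) _ _)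
         (cong (Vec.toList (leavesBelowNode v) ++_) (sym (replicate-+ (leaves r) j false)))) ⟩
  replicate i false ++ Vec.toList (leavesBelowNode v) ++ replicate (leaves r ∔ j) false
    ≡⟨ leavesBelowNode-block i (leaves r ∔ j) v ⟩
  block a s (i ∔ leaves l ∔ (leaves r ∔ j) ∸ (a ∔ s))
    ≡⟨ cong (λ n → block a s (n ∸ (a ∔ s)))
         (trans (sym (+-assoc (i ∔ leaves l) (leaves r) j))
                (cong (_∔ j) (+-assoc i (leaves l) (leaves r)))) ⟩
  block a s (i ∔ (leaves l ∔ leaves r) ∔ j ∸ (a ∔ s)) ∎
  where
  open ≡-Reasoning
  a = proj₁ (spanOf i v)
  s = proj₂ (spanOf i v)
leavesBelowNode-block i j {node l r} (right v) = begin
  replicate i false ++ Vec.toList (Vec.replicate (leaves l) false Vec.++ leavesBelowNode v) ++ replicate j false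
    ≡⟨ cong (λ xs → replicate i false ++ xs ++ replicate j false)
         (trans (Vec.toList-++ (Vec.replicate (leaves l) false) _)
                (cong (_++ Vec.toList (leavesBelowNode v)) (Vec.toList-replicate (leaves l) false))) ⟩
  replicate i false ++ (replicate (leaves l) false ++ Vec.toList (leavesBelowNode v)) ++ replicate j false
    ≡⟨ cong (replicate i false ++_) (++-assoc (replicate (leaves l) false) _ _) ⟩
  replicate i false ++ replicate (leaves l) false ++ Vec.toList (leavesBelowNode v) ++ replicate j false
    ≡⟨ ++-assoc (replicate i false) _ _ ⟨
  (replicate i false ++ replicate (leaves l) false) ++ Vec.toList (leavesBelowNode v) ++ replicate j false
    ≡⟨ cong (_++ _) (replicate-+ i (leaves l) false) ⟨
  replicate (i ∔ leaves l) false ++ Vec.toList (leavesBelowNode v) ++ replicate j false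
    ≡⟨ leavesBelowNode-block (i ∔ leaves l) j v ⟩
  block a s (i ∔ leaves l ∔ leaves r ∔ j ∸ (a ∔ s))
    ≡⟨ cong (λ n → block a s (n ∔ j ∸ (a ∔ s))) (+-assoc i (leaves l) (leaves r)) ⟩
  block a s (i ∔ (leaves l ∔ leaves r) ∔ j ∸ (a ∔ s)) ∎
  where
  open ≡-Reasoning
  a = proj₁ (spanOf (i ∔ leaves l) v)
  s = proj₂ (spanOf (i ∔ leaves l) v)

0<spanOf : ∀ i {t} (v : InteriorNode t) → 0 ℕ.< proj₂ (spanOf i v)
0<spanOf i {t} root          = 0<leaves t
0<spanOf i (left v)          = 0<spanOf i v
0<spanOf i (right {l = l} v) = 0<spanOf (i ∔ leaves l) v

leavesBelow-block : ∀ {t} (e : InternalEdge t) → let (a , s) = edgeSpan e in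
                    Vec.toList (leavesBelow e) ≡ block a s (leaves t ∸ (a ∔ s))
leavesBelow-block {t} e = begin
  Vec.toList (leavesBelow e)
    ≡⟨ cong Vec.toList (leavesBelow-lowerEndpoint e) ⟩
  Vec.toList (leavesBelowNode (lowerEndpoint e))
    ≡⟨ ++-identityʳ _ ⟨
  Vec.toList (leavesBelowNode (lowerEndpoint e)) ++ []
    ≡⟨ leavesBelowNode-block 0 0 (lowerEndpoint e) ⟩
  block a s (leaves t ∔ 0 ∸ (a ∔ s))
    ≡⟨ cong (λ n → block a s (n ∸ (a ∔ s))) (+-identityʳ (leaves t)) ⟩
  block a s (leaves t ∸ (a ∔ s)) ∎
  where
  open ≡-Reasoning
  a = proj₁ (edgeSpan e)
  s = proj₂ (edgeSpan e)

-- Passing to lists removes the cast along `eq`, and `block-injective` reads off the span.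
-- Conversely, a span and the total number of leaves fix the whole block.
CommonEdgePair⇔edgeSpan : ∀ S T eq e₁ e₂ →
                          CommonEdgePair S T eq e₁ e₂ ⇔ edgeSpan e₁ ≡ edgeSpan e₂
CommonEdgePair⇔edgeSpan S T eq e₁ e₂ = mk⇔
  (λ below≡ → block-injective {q = padding S e₁} {padding T e₂}
    (0<spanOf 0 (lowerEndpoint e₁)) (0<spanOf 0 (lowerEndpoint e₂))
    (trans (sym (leavesBelow-block e₁))
      (trans (sym (Vec.toList-cast eq (leavesBelow e₁)))
        (trans (cong Vec.toList below≡) (leavesBelow-block e₂)))))
  (λ span≡ → Vec.toList-injective eq (leavesBelow e₁) (leavesBelow e₂)
    (trans (leavesBelow-block e₁)
      (trans (cong₂ (λ n (a , s) → block a s (n ∸ (a ∔ s))) eq span≡)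
        (sym (leavesBelow-block e₂)))))
  where
  padding : ∀ t → InternalEdge t → ℕ
  padding t e = let (a , s) = edgeSpan e in leaves t ∸ (a ∔ s)

IsCommonEdge⇔edgeSpan∈ : ∀ S T eq e → IsCommonEdge S T eq e ⇔ edgeSpan e ∈ spans 0 T
IsCommonEdge⇔edgeSpan∈ (node l r) T@(node l′ r′) eq e = mk⇔
  (λ common → let e₂ , e₂∈ , pair = find common in
    there (subst (edgeSpan e ∈_) (map-edgeSpan l′ r′)
      (subst (_∈ map edgeSpan (internalEdges T))
        (sym (Equivalence.to (CommonEdgePair⇔edgeSpan (node l r) T eq e e₂) pair))
        (∈-map⁺ edgeSpan e₂∈))))
  -- The first entry of `spans 0 T` belongs to the root, not to an edge. It contains all leaves,
  -- whereas an edge of `S` has strictly fewer below it.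
  (λ { (here span≡) → contradiction (trans (cong proj₂ span≡) (sym eq)) (<⇒≢ (edge-< e))
     ; (there span∈) →
         let e₂ , e₂∈ , span≡ = ∈-map⁻ edgeSpan
                                  (subst (edgeSpan e ∈_) (sym (map-edgeSpan l′ r′)) span∈)
         in lose e₂∈ (Equivalence.from (CommonEdgePair⇔edgeSpan (node l r) T eq e e₂) span≡) })
  where
  edge∈ : ∀ {t} (e : InternalEdge t) → e ∈ internalEdges t
  node∈ : ∀ {t} (v : InteriorNode t) → v ∈ interiorNodes t
  node∈ root                = here refl
  node∈ (left v)            = there (∈-++⁺ˡ (∈-map⁺ left (node∈ v)))
  node∈ (right {l = l} v)   = there (∈-++⁺ʳ (map left (interiorNodes l)) (∈-map⁺ right (node∈ v)))
  edge∈ (left v)            = ∈-++⁺ˡ (∈-map⁺ left (node∈ v))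
  edge∈ (right {l = l} v)   = ∈-++⁺ʳ (map left (interiorNodes l)) (∈-map⁺ right (node∈ v))

  edge-< : ∀ (e : InternalEdge (node l r)) → proj₂ (edgeSpan e) ℕ.< leaves (node l r)
  edge-< e = span-of-child-< l r (subst (edgeSpan e ∈_) (map-edgeSpan l r) (∈-map⁺ edgeSpan (edge∈ e)))
IsCommonEdge⇔edgeSpan∈ (node l r) leaf eq e =
  contradiction (sym eq) (<⇒≢ (≤-<-trans (0<leaves l) (leaves-left-< l r)))

-- The number of differing spans and the two bounds.

differing : Tree → Tree → ℕ
differing S T = count (¬? ∘ (_∈? spans 0 T)) (spans 0 S)

-- The `suc` accounts for the root, whose span is common although no internal edge ends there.
-- Distinctness excludes a pair of single leaves, where there is no such root.
count-common : ∀ S T → S ≢ T → (eq : leaves S ≡ leaves T) →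
               suc (commonEdges S T eq) ≡ count (_∈? spans 0 T) (spans 0 S)
count-common leaf       leaf         S≢T eq = contradiction refl S≢T
count-common leaf       (node l r)   S≢T eq =
  contradiction eq (<⇒≢ (≤-<-trans (0<leaves l) (leaves-left-< l r)))
count-common (node l r) leaf         S≢T eq =
  contradiction (sym eq) (<⇒≢ (≤-<-trans (0<leaves l) (leaves-left-< l r)))
count-common S@(node l r) T@(node l′ r′) S≢T eq = begin
  suc (commonEdges S T eq)
    ≡⟨ cong suc (count-map (isCommonEdge? S T eq) (_∈? spans 0 T) edgeSpan (internalEdges S)
         (λ {e} _ → IsCommonEdge⇔edgeSpan∈ S T eq e)) ⟩
  suc (count (_∈? spans 0 T) (map edgeSpan (internalEdges S)))
    ≡⟨ cong (suc ∘ count (_∈? spans 0 T)) (map-edgeSpan l r) ⟩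
  suc (count (_∈? spans 0 T) (spans 0 l ++ spans (leaves l) r))
    ≡⟨ cong length (filter-accept (_∈? spans 0 T) (here (cong (0 ,_) eq))) ⟨
  count (_∈? spans 0 T) (spans 0 S) ∎
  where open ≡-Reasoning

interior-differing : ∀ S T → S ≢ T → (eq : leaves S ≡ leaves T) →
                     interior S ≡ suc (commonEdges S T eq) ∔ differing S T
interior-differing S T S≢T eq = begin
  interior S             ≡⟨ length-spans 0 S ⟨
  length (spans 0 S)     ≡⟨ count+count-¬ (_∈? spans 0 T) (spans 0 S) ⟨
  count (_∈? spans 0 T) (spans 0 S) ∔ differing S T
    ≡⟨ cong (_∔ differing S T) (count-common S T S≢T eq) ⟨
  suc (commonEdges S T eq) ∔ differing S T ∎
  where open ≡-Reasoning

differing-refl : ∀ T → differing T T ≡ 0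
differing-refl T =
  cong length (filter-none (¬? ∘ (_∈? spans 0 T)) (All.tabulate (λ x∈ x∉ → x∉ x∈)))

-- The count of spans missing from `T` drops by at most one per rotation and has to reach zero at
-- `T`.
differing-≤-rotations : ∀ {d S T} → Rotations d S T → differing S T ≤ℕ d
differing-≤-rotations {d} {S} {T} ρs = begin
  differing S T     ≤⟨ rotations-count (¬? ∘ (_∈? spans 0 T)) 0 ρs ⟩
  d ∔ differing T T ≡⟨ cong (d ∔_) (differing-refl T) ⟩
  d ∔ 0             ≡⟨ +-identityʳ d ⟩
  d                 ∎
  where open ≤-Reasoning

module _ (S T : Tree) (eq : leaves S ≡ leaves T) where

  Common : Pred Span 0ℓ
  Common x = x ∈ spans 0 S × x ∈ spans 0 T

  common? : Decidable Common
  common? x = (x ∈? spans 0 S) ×-dec (x ∈? spans 0 T)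

  unmarked-S : unmarked common? 0 S ≡ differing S T
  unmarked-S = trans
    (count-map (¬? ∘ common?) (¬? ∘ (_∈? spans 0 T)) id (spans 0 S)
      (λ x∈ → mk⇔ (λ ¬c x∈T → ¬c (x∈ , x∈T)) (λ x∉T (_ , x∈T) → x∉T x∈T)))
    (cong (count (¬? ∘ (_∈? spans 0 T))) (map-id (spans 0 S)))

  -- Both trees have equally many spans, and the common ones are equally many in each list, so the
  -- remainders agree. Hence the same budget serves `T`.
  unmarked-T : unmarked common? 0 T ≡ differing S T
  unmarked-T = trans (+-cancelˡ-≡ (count common? (spans 0 S)) _ _ (begin
    count common? (spans 0 S) ∔ unmarked common? 0 T
      ≡⟨ cong (_∔ unmarked common? 0 T)
           (count-unique common? (spans-unique 0 S) (spans-unique 0 T) proj₁ proj₂) ⟩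
    count common? (spans 0 T) ∔ unmarked common? 0 T ≡⟨ count+count-¬ common? (spans 0 T) ⟩
    length (spans 0 T)                               ≡⟨ length-spans 0 T ⟩
    interior T                                       ≡⟨ interior-≡ ⟨
    interior S                                       ≡⟨ length-spans 0 S ⟨
    length (spans 0 S)                               ≡⟨ count+count-¬ common? (spans 0 S) ⟨
    count common? (spans 0 S) ∔ unmarked common? 0 S ∎)) unmarked-S
    where
    open ≡-Reasoning
    interior-≡ : interior S ≡ interior T
    interior-≡ = suc-injective
      (trans (sym (leaves≡suc-interior S)) (trans eq (leaves≡suc-interior T)))

  normalForm : ∀ U → ∃[ R ] Normal {Common} 0 R × Reduces {Common} 0 (unmarked common? 0 U) U R
  normalForm leaf       = leaf , leaf , Reduces-refl
  normalForm (node l r) =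
    let R , nR , p = normalise common? 0 l r
    in R , nR , Reduces-≤ (unmarked-children common? 0 l r) p

  rotations-≤-differing : ∃[ d ] d ≤ℕ 2 ℕ.* differing S T × Rotations d S T
  rotations-≤-differing with normalForm S | normalForm T
  ... | R , nR , p | Q , nQ , q = _ , bound ,
    rotations p ++ᴿ subst (λ U → Rotations (steps q) U T) (sym R≡Q) (reverseᴿ (rotations q))
    where
    open Reduces
    R≡Q : R ≡ Q
    R≡Q = Normal-unique {Common} nR nQ (trans (sym (leaves≡ p)) (trans eq (leaves≡ q)))
      -- A common span occurs in both `S` and `T`, so each reduction preserves it.
      (λ m _ → keeps p m (proj₁ m)) (λ m _ → keeps q m (proj₂ m))

    bound : steps p ∔ steps q ≤ℕ 2 ℕ.* differing S T
    bound = ≤-trans (+-mono-≤ (≤-trans (steps≤ p) (≤-reflexive unmarked-S))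
                              (≤-trans (steps≤ q) (≤-reflexive unmarked-T)))
                    (≤-reflexive (cong (differing S T ∔_) (sym (+-identityʳ _))))

theorem1 : (S T : Tree) → S ≢ T → (eq : leaves S ≡ leaves T) →
    let n = interior S
        e = commonEdges S T eq
        d = rotationDistance S T eq
    in (+ n - + e - + 1 ≤ + d) × (+ d ≤ + 2 * (+ n - + e - + 1))
theorem1 S T S≢T eq =
  -- Over the integers `n - e - 1` equals `differing S T`, which turns both bounds into inequalities
  -- of natural numbers. The lower one is applied to a shortest sequence of rotations, the upper one
  -- compares it with the route through the normal form.
  subst (λ z → z ≤ + d × + d ≤ + 2 * z) (sym differing≡)
    (+≤+ (differing-≤-rotations (proj₁ isLeast)) ,
     subst (+ d ≤_) (pos-* 2 (differing S T)) (+≤+ upper))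
  where
  d = rotationDistance S T eq
  e = commonEdges S T eq
  isLeast = rotationDistance-isLeast S T eq

  cancel : ∀ x y → (+ 1 +ℤ x) +ℤ y - x - + 1 ≡ y
  cancel = solve-∀

  differing≡ : + interior S - + e - + 1 ≡ + differing S T
  differing≡ = trans
    (cong (λ n → + n - + e - + 1) (interior-differing S T S≢T eq))
    (cancel (+ e) (+ differing S T))

  upper : d ≤ℕ 2 ℕ.* differing S T
  upper = let _ , k≤ , ρs = rotations-≤-differing S T eq in ≤-trans (proj₂ isLeast ρs) k≤
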